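{- Let $n\ge 2$ be an integer and let $T$ be a spanning tree of the $n$-grid $G_{n,n}$. Then the average length of a fundamental cycle with respect to $T$ is at least $\frac{2}{625}\left\lfloor\log_5 n\right\rfloor$.
   Context: The $n$-grid $G_{n,n}$ is the Cartesian product of two $n$-vertex paths. If $T$ is a spanning tree of a graph $G$ and $e$ is an edge of $G$ not contained in $T$, the fundamental cycle associated with $e$ (with respect to $T$) is the cycle formed by $e$ and the unique path of $T$ joining the two end vertices of $e$. Its length is its number of edges. The average length of a fundamental cycle with respect to $T$ is the arithmetic mean of the lengths of the fundamental cycles associated with all edges of $G$ not contained in $T$. -}

module Defs where

open import Data.Bool using (if_then_else_)
open import Data.Fin using (Fin; suc; inject₁)
import Data.Fin.Properties as Fin
open import Data.Integer using (+_)
open import Data.List using (List; []; _∷_; _++_; map; mapMaybe; length; allFin; cartesianProduct)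
open import Data.List.Membership.Propositional using (_∈_)
open import Data.List.Membership.Propositional.Properties using (∈-allFin; ∈-cartesianProduct⁺; ∈-++⁺ˡ; ∈-++⁺ʳ; ∈-map⁺; ∈-map⁻)
open import Data.List.Relation.Unary.All as All using (All; []; _∷_)
open import Data.List.Relation.Unary.All.Properties using (¬Any⇒All¬)
open import Data.List.Relation.Unary.AllPairs using ([]; _∷_)
open import Data.List.Relation.Unary.Any using (here; there; any?)
open import Data.List.Relation.Unary.Unique.Propositional using (Unique)
open import Data.List.Relation.Unary.Unique.Propositional.Properties using (allFin⁺; cartesianProduct⁺; ++⁺; map⁺)
import Data.Maybe as Maybe
open import Data.Nat using (ℕ; zero; suc; pred; _^_; _<_; _≤ᵇ_; z<s)
open import Data.Nat.ListAction using (sum)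
open import Data.Product using (Σ; ∃; _×_; _,_; proj₁; proj₂)
open import Data.Product.Properties using (≡-dec)
open import Data.Rational using (ℚ; 0ℚ; _/_)
open import Data.Sum using (_⊎_; inj₁; inj₂)
open import Data.Sum.Properties using (inj₁-injective; inj₂-injective)
open import Level using (0ℓ)
open import Relation.Binary.Definitions using (DecidableEquality)
open import Relation.Binary.PropositionalEquality using (_≡_; refl)
open import Relation.Nullary using (¬_; yes; no)
open import Relation.Nullary.Decidable using (¬?; dec⇒maybe)
open import Relation.Unary using (Pred; Decidable)

-- Finite undirected graphs.  Every edge is a single element of E; which of its
-- two ends is called `tail` and which `head` carries no meaning (see `Joins`).
record Graph : Set₁ where
  field
    V E             : Set
    tail head       : E → V
    _≟_             : DecidableEquality V
    vertices        : List V
    vertices-all    : ∀ v → v ∈ vertices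
    vertices-unique : Unique vertices
    edges           : List E
    edges-all       : ∀ e → e ∈ edges
    edges-unique    : Unique edges

pathTail pathHead : ∀ n → Fin (pred n) → Fin n
pathTail (suc n) i = inject₁ i
pathHead (suc n) i = suc i

-- The path on vertices 0, 1, …, n-1: edge i joins i to i+1.
pathGraph : ℕ → Graph
pathGraph n = record
  { V               = Fin n
  ; E               = Fin (pred n)
  ; tail            = pathTail n
  ; head            = pathHead n
  ; _≟_             = Fin._≟_
  ; vertices        = allFin n
  ; vertices-all    = ∈-allFin
  ; vertices-unique = allFin⁺ n
  ; edges           = allFin (pred n)
  ; edges-all       = ∈-allFin
  ; edges-unique    = allFin⁺ (pred n)
  }

-- Cartesian product: an edge moves along an edge of one factor while the
-- coordinate in the other factor stays fixed.
infixr 7 _□_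
_□_ : Graph → Graph → Graph
G □ H = record
  { V               = G.V × H.V
  ; E               = (G.E × H.V) ⊎ (G.V × H.E)
  ; tail            = λ { (inj₁ (e , h)) → G.tail e , h ; (inj₂ (g , e)) → g , H.tail e }
  ; head            = λ { (inj₁ (e , h)) → G.head e , h ; (inj₂ (g , e)) → g , H.head e }
  ; _≟_             = ≡-dec G._≟_ H._≟_
  ; vertices        = cartesianProduct G.vertices H.vertices
  ; vertices-all    = λ (g , h) → ∈-cartesianProduct⁺ (G.vertices-all g) (H.vertices-all h)
  ; vertices-unique = cartesianProduct⁺ G.vertices-unique H.vertices-unique
  ; edges           = map inj₁ (cartesianProduct G.edges H.vertices)
                      ++ map inj₂ (cartesianProduct G.vertices H.edges)
  ; edges-all       = λ
      { (inj₁ (e , h)) → ∈-++⁺ˡ (∈-map⁺ inj₁ (∈-cartesianProduct⁺ (G.edges-all e) (H.vertices-all h)))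
      ; (inj₂ (g , e)) → ∈-++⁺ʳ (map inj₁ (cartesianProduct G.edges H.vertices))
                           (∈-map⁺ inj₂ (∈-cartesianProduct⁺ (G.vertices-all g) (H.edges-all e)))
      }
  ; edges-unique    = ++⁺ (map⁺ inj₁-injective (cartesianProduct⁺ G.edges-unique H.vertices-unique))
                          (map⁺ inj₂-injective (cartesianProduct⁺ G.vertices-unique H.edges-unique))
                          (λ { (p , q) → inj-disjoint p q })
  }
  where
  module G = Graph G
  module H = Graph H

  inj-disjoint : {A B : Set} {xs : List A} {ys : List B} {z : A ⊎ B} →
                 z ∈ map inj₁ xs → ¬ z ∈ map inj₂ ys
  inj-disjoint p q with ∈-map⁻ inj₁ p | ∈-map⁻ inj₂ q
  ... | _ , _ , refl | _ , _ , ()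

grid : ℕ → Graph
grid n = pathGraph n □ pathGraph n

module _ (G : Graph) where
  open Graph G

  Joins : E → V → V → Set
  Joins e u v = (tail e ≡ u × head e ≡ v) ⊎ (tail e ≡ v × head e ≡ u)

  data Walk : V → V → Set where
    nil  : ∀ {u} → Walk u u
    step : ∀ {u v w} (e : E) → Joins e u v → Walk v w → Walk u w

module _ {G : Graph} where
  open Graph G

  walkEdges : ∀ {u v} → Walk G u v → List E
  walkEdges nil          = []
  walkEdges (step e _ p) = e ∷ walkEdges p

  walkLength : ∀ {u v} → Walk G u v → ℕ
  walkLength p = length (walkEdges p)

  -- All vertices of the walk, in order, except its starting vertex.
  laterVertices : ∀ {u v} → Walk G u v → List V
  laterVertices nil                  = []
  laterVertices (step {v = v} _ _ p) = v ∷ laterVertices p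

  walkVertices : ∀ {u v} → Walk G u v → List V
  walkVertices {u} p = u ∷ laterVertices p

  IsPath : ∀ {u v} → Walk G u v → Set
  IsPath p = Unique (walkVertices p)

  -- For a closed walk, `laterVertices` lists the vertices with the base point
  -- counted once.  Distinctness of the edges excludes going back and forth
  -- along a single edge.
  IsCycle : ∀ {u} → Walk G u u → Set
  IsCycle p = 0 < walkLength p × Unique (laterVertices p) × Unique (walkEdges p)

record Cycle (G : Graph) : Set where
  constructor mkCycle
  field
    {base}  : Graph.V G
    walk    : Walk G base base
    isCycle : IsCycle walk

cycleLength : ∀ {G} → Cycle G → ℕ
cycleLength C = walkLength (Cycle.walk C)

-- A spanning tree is given by its edge set; it contains all vertices of G.
record SpanningTree (G : Graph) : Set₁ where
  open Graph G
  field
    InTree    : Pred E 0ℓ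
    inTree?   : Decidable InTree
    connected : ∀ u v → Σ (Walk G u v) λ p → All InTree (walkEdges p)
    acyclic   : ∀ {u} (p : Walk G u u) → IsCycle p → ¬ All InTree (walkEdges p)

module _ {G : Graph} where
  open Graph G

  PathIn : Pred E 0ℓ → V → V → Set
  PathIn P u v = Σ (Walk G u v) λ p → IsPath p × All P (walkEdges p)

  module _ {P : Pred E 0ℓ} where

    suffixFrom : ∀ {u v x} (p : Walk G u v) → IsPath p → All P (walkEdges p) →
                 x ∈ walkVertices p → PathIn P x v
    suffixFrom p            uq       ps       (here refl) = p , uq , ps
    suffixFrom (step e j p) (_ ∷ uq) (_ ∷ ps) (there x∈)  = suffixFrom p uq ps x∈

    -- Loop erasure.
    toPath : ∀ {u v} (p : Walk G u v) → All P (walkEdges p) → PathIn P u v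
    toPath nil []                       = nil , [] ∷ [] , []
    toPath (step {u} e j p) (pe ∷ ps) with toPath p ps
    ... | q , uq , qs with any? (u ≟_) (walkVertices q)
    ...   | yes u∈ = suffixFrom q uq qs u∈
    ...   | no  u∉ = step e j q , ¬Any⇒All¬ _ u∉ ∷ uq , pe ∷ qs

  ends∈ : ∀ {u v e} (p : Walk G u v) → e ∈ walkEdges p →
          tail e ∈ walkVertices p × head e ∈ walkVertices p
  ends∈ (step e (inj₁ (refl , refl)) p) (here refl) = here refl , there (here refl)
  ends∈ (step e (inj₂ (refl , refl)) p) (here refl) = there (here refl) , here refl
  ends∈ (step e j p) (there e∈) = let t , h = ends∈ p e∈ in there t , there h

  path-edges-unique : ∀ {u v} (p : Walk G u v) → IsPath p → Unique (walkEdges p)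
  path-edges-unique nil _ = []
  path-edges-unique (step {u} e j p) (u∉ ∷ uq) = ¬Any⇒All¬ _ (e∉ j) ∷ path-edges-unique p uq
    where
    e∉ : Joins G e u _ → ¬ e ∈ walkEdges p
    e∉ (inj₁ (refl , _)) e∈ = All.lookup u∉ (proj₁ (ends∈ p e∈)) refl
    e∉ (inj₂ (_ , refl)) e∈ = All.lookup u∉ (proj₂ (ends∈ p e∈)) refl

module _ {G : Graph} (T : SpanningTree G) where
  open Graph G
  open SpanningTree T

  treePath : ∀ u v → PathIn InTree u v
  treePath u v = let p , ps = connected u v in toPath p ps

  -- The edge e from its tail to its head, then back along the path of T.  That
  -- path is unique by acyclicity, so the choice of walks in `connected` is immaterial.
  fundamentalCycle : (e : E) → ¬ InTree e → Cycle G
  fundamentalCycle e e∉T =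
    let p , isPath , p⊆T = treePath (head e) (tail e)
    in mkCycle (step e (inj₁ (refl , refl)) p)
         ( z<s
         , isPath
         , ¬Any⇒All¬ _ (λ e∈p → e∉T (All.lookup p⊆T e∈p)) ∷ path-edges-unique p isPath
         )

  nonTreeEdges : List (∃ λ e → ¬ InTree e)
  nonTreeEdges = mapMaybe (λ e → Maybe.map (e ,_) (dec⇒maybe (¬? (inTree? e)))) edges

  fundamentalCycleLengths : List ℕ
  fundamentalCycleLengths = map (λ (e , e∉T) → cycleLength (fundamentalCycle e e∉T)) nonTreeEdges

-- The value at the empty list is a convention.  It is not used for the n-grid
-- with n ≥ 2: an acyclic edge set misses an edge of each 4-cycle.
mean : List ℕ → ℚ
mean []         = 0ℚ
mean xs@(_ ∷ _) = + sum xs / length xs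

averageFundamentalCycleLength : ∀ {G} → SpanningTree G → ℚ
averageFundamentalCycleLength T = mean (fundamentalCycleLengths T)

-- The greatest k ≤ m with b ^ k ≤ n (and 0 if there is none).
greatestExponent : (b n m : ℕ) → ℕ
greatestExponent b n zero    = 0
greatestExponent b n (suc m) = if b ^ suc m ≤ᵇ n then suc m else greatestExponent b n m

-- ⌊log_b n⌋ for b ≥ 2 and n ≥ 1: the greatest k with b ^ k ≤ n.  As n < b ^ n,
-- searching k ≤ n suffices.
⌊log[_]_⌋ : ℕ → ℕ → ℕ
⌊log[ b ] n ⌋ = greatestExponent b n n

{-# OPTIONS --safe #-}

-- Fix a unit square of the grid and count, modulo 2, how often a walk crosses a ray
-- starting in it.  Closed walks in T are even, so crossing parity has a potential on T.
-- The boundary of a concentric square of side 2j + 1 is odd, hence one of its edges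
-- closes to an odd fundamental cycle; crossing both opposite rays, that cycle reaches from
-- the boundary to beyond the centre and is longer than j.  Translating the square over
-- s² positions, each edge is met at most 2(2j + 1) times, so at least s² / 4(j + 1) edges
-- have a fundamental cycle longer than j.  Summing over j < 5 ^ K gives a harmonic sum,
-- whose blocks 5 ^ i ≤ j < 5 ^ (i + 1) each contribute s² / 5.

module Submission where

open import Defs
open import Data.Bool as Bool using (Bool; true; false; _xor_; _∧_; not; if_then_else_)
open import Data.Bool.Properties using (xor-assoc; xor-comm; xor-same; xor-identityʳ; not-distribˡ-xor; not-distribʳ-xor; xor-annihilates-not)
open import Data.Empty using (⊥-elim)
open import Data.Fin using (Fin; zero; suc; toℕ; inject₁)
open import Data.Fin.Properties using (toℕ-inject₁)
import Data.Integer as ℤ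
import Data.Integer.Properties as ℤ
open import Data.List using (List; []; _∷_; _++_; map; mapMaybe; length; tabulate; allFin; cartesianProduct)
open import Data.List.Membership.Propositional using (_∈_)
open import Data.List.Properties using (map-++; map-∘; map-tabulate; length-++; length-map; length-tabulate; length-mapMaybe)
open import Data.List.Relation.Unary.All as All using (All; []; _∷_)
open import Data.List.Relation.Unary.All.Properties using (¬Any⇒All¬)
open import Data.List.Relation.Unary.AllPairs using ([]; _∷_)
open import Data.List.Relation.Unary.Any using (here; there; any?)
open import Data.Maybe as Maybe using (Maybe; just; nothing; maybe′)
open import Data.Nat as ℕ using (ℕ; zero; suc; z≤n; s≤s; z<s; _^_; _∸_; _<_; _<ᵇ_; _≡ᵇ_; _≤ᵇ_)
open import Data.Nat.ListAction using (sum)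
open import Data.Nat.ListAction.Properties using (sum-++)
open import Data.Nat.Properties hiding (_≟_)
open import Data.Nat.Tactic.RingSolver using (solve-∀)
open import Data.Product using (Σ; ∃; _×_; _,_; proj₁; proj₂)
import Data.Rational.Properties as ℚ
open import Data.Rational.Unnormalised as ℚᵘ using (mkℚᵘ; *≤*)
import Data.Rational.Unnormalised.Properties as ℚᵘ
open import Data.Sum using (_⊎_; inj₁; inj₂)
open import Function using (_∘_)
open import Relation.Binary.PropositionalEquality
open import Relation.Nullary using (¬_; yes; no)
open import Relation.Nullary.Decidable using (¬?; dec⇒maybe)

-- Crossing parity of tree walks

module _ {G : Graph} (c : Graph.E G → Bool) where
  open Graph G

  parity : ∀ {u v} → Walk G u v → Bool
  parity nil          = false
  parity (step e _ p) = c e xor parity p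

  parity-odd⇒∃ : ∀ {u v} (p : Walk G u v) → parity p ≡ true →
                 ∃ λ e → e ∈ walkEdges p × c e ≡ true
  parity-odd⇒∃ (step e _ p) odd with c e in ce
  ... | true  = e , here refl , ce
  ... | false = let e′ , e′∈p , ce′ = parity-odd⇒∃ p odd in e′ , there e′∈p , ce′

xor-interchange : ∀ w x y z → (w xor x) xor (y xor z) ≡ (y xor w) xor (z xor x)
xor-interchange false false y z = cong₂ _xor_ (sym (xor-identityʳ y)) (sym (xor-identityʳ z))
xor-interchange false true  y z = trans (not-distribʳ-xor y z) (cong₂ _xor_ (sym (xor-identityʳ y)) (xor-comm true z))
xor-interchange true  false y z = trans (not-distribˡ-xor y z) (cong₂ _xor_ (xor-comm true y) (sym (xor-identityʳ z)))
xor-interchange true  true  y z = trans (sym (xor-annihilates-not y z)) (cong₂ _xor_ (xor-comm true y) (xor-comm true z))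

parity-xor : ∀ {G} (c d : Graph.E G → Bool) {u v} (p : Walk G u v) →
             parity (λ e → c e xor d e) p ≡ parity c p xor parity d p
parity-xor c d nil          = refl
parity-xor c d (step e _ p) = trans (cong ((c e xor d e) xor_) (parity-xor c d p))
  (trans (xor-interchange (c e) (d e) (parity c p) (parity d p))
         (cong₂ _xor_ (xor-comm (parity c p) (c e)) (xor-comm (parity d p) (d e))))

-- The edge values telescope: every intermediate vertex enters twice and cancels modulo 2, so only
-- the two ends of the walk remain.
parity-coboundary : ∀ {G} (c : Graph.E G → Bool) (f : Graph.V G → Bool) →
  (∀ e → c e ≡ f (Graph.tail G e) xor f (Graph.head G e)) →
  ∀ {u v} (p : Walk G u v) → parity c p ≡ f u xor f v
parity-coboundary c f c≡ (nil {u}) = sym (xor-same (f u))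
parity-coboundary {G} c f c≡ (step {u} {v} {w} e j p) = begin
  c e xor parity c p              ≡⟨ cong₂ _xor_ (ce≡ j) (parity-coboundary c f c≡ p) ⟩
  (f u xor f v) xor (f v xor f w) ≡⟨ telescope (f u) (f v) (f w) ⟩
  f u xor f w                     ∎
  where
  open ≡-Reasoning
  ce≡ : Joins G e u v → c e ≡ f u xor f v
  ce≡ (inj₁ (refl , refl)) = c≡ e
  ce≡ (inj₂ (refl , refl)) = trans (c≡ e) (xor-comm (f v) (f u))
  telescope : ∀ x y z → (x xor y) xor (y xor z) ≡ x xor z
  telescope false false _ = refl
  telescope false true  false = refl
  telescope false true  true = refl
  telescope true  false _ = refl
  telescope true  true  _ = refl

module _ {G : Graph} (T : SpanningTree G) where
  open Graph G
  open SpanningTree T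

  TreeWalk : V → V → Set
  TreeWalk u v = Σ (Walk G u v) λ p → All InTree (walkEdges p)

  infixr 5 _⊕_
  _⊕_ : ∀ {u v w} → TreeWalk u v → TreeWalk v w → TreeWalk u w
  (nil , []) ⊕ q = q
  (step e j p , pe ∷ ps) ⊕ q = let r , rs = (p , ps) ⊕ q in step e j r , pe ∷ rs

  Joins-sym : ∀ {e u v} → Joins G e u v → Joins G e v u
  Joins-sym (inj₁ j) = inj₂ j
  Joins-sym (inj₂ j) = inj₁ j

  reverse : ∀ {u v} → TreeWalk u v → TreeWalk v u
  reverse (nil , []) = nil , []
  reverse (step e j p , pe ∷ ps) = reverse (p , ps) ⊕ (step e (Joins-sym j) nil , pe ∷ [])

  module _ (c : E → Bool) where

    private
      par : ∀ {u v} → TreeWalk u v → Bool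
      par (p , _) = parity c p

    parity-⊕ : ∀ {u v w} (p : TreeWalk u v) (q : TreeWalk v w) → par (p ⊕ q) ≡ par p xor par q
    parity-⊕ (nil , []) q = refl
    parity-⊕ (step e j p , pe ∷ ps) q =
      trans (cong (c e xor_) (parity-⊕ (p , ps) q)) (sym (xor-assoc (c e) (parity c p) (par q)))

    parity-reverse : ∀ {u v} (p : TreeWalk u v) → par (reverse p) ≡ par p
    parity-reverse (nil , []) = refl
    parity-reverse (step e j p , pe ∷ ps) = begin
      par (reverse (p , ps) ⊕ _)                 ≡⟨ parity-⊕ (reverse (p , ps)) _ ⟩
      par (reverse (p , ps)) xor (c e xor false) ≡⟨ cong₂ _xor_ (parity-reverse (p , ps)) (xor-identityʳ (c e)) ⟩
      parity c p xor c e                         ≡⟨ xor-comm (parity c p) (c e) ⟩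
      c e xor parity c p                         ∎
      where open ≡-Reasoning

    -- A path of T cut at `x`, as loop erasure needs it, with the parity of both pieces recorded.
    -- `before-⊆` ranges over all predicates because it has to hand on the freshness of a first
    -- vertex to the shortened path.
    record Split {v w} (q : Walk G v w) (x : V) : Set₁ where
      field
        before       : Walk G v x
        before-path  : IsPath before
        before-tree  : All InTree (walkEdges before)
        before-⊆     : ∀ {P : V → Set} → All P (walkVertices q) → All P (walkVertices before)
        after        : Walk G x w
        after-path   : IsPath after
        after-tree   : All InTree (walkEdges after)
        parity-split : parity c q ≡ parity c before xor parity c after

    split : ∀ {v w x} (q : Walk G v w) → IsPath q → All InTree (walkEdges q) →
            x ∈ walkVertices q → Split q x
    split q uq qs (here refl) = record
      { before = nil ; before-path = [] ∷ [] ; before-tree = [] ; before-⊆ = λ { (p ∷ _) → p ∷ [] }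
      ; after = q ; after-path = uq ; after-tree = qs ; parity-split = refl }
    split (step e j q) (v∉ ∷ uq) (qe ∷ qs) (there x∈) = record
      { before = step e j before
      ; before-path = before-⊆ v∉ ∷ before-path
      ; before-tree = qe ∷ before-tree
      ; before-⊆ = λ { (p ∷ ps) → p ∷ before-⊆ ps }
      ; after = after ; after-path = after-path ; after-tree = after-tree
      ; parity-split = trans (cong (c e xor_) parity-split)
                             (sym (xor-assoc (c e) (parity c before) (parity c after))) }
      where open Split (split q uq qs x∈)

    -- A nonempty walk lists its last vertex among the later ones, so a path that returns to its
    -- start is `nil`.
    closedPath-even : ∀ {u} (p : Walk G u u) → IsPath p → parity c p ≡ false
    closedPath-even nil _ = refl
    closedPath-even (step e j p) (u∉ ∷ _) = ⊥-elim (All.lookup u∉ (end∈ p) refl)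
      where
      end∈ : ∀ {u v} (p : Walk G u v) → v ∈ walkVertices p
      end∈ nil          = here refl
      end∈ (step _ _ p) = there (end∈ p)

    -- A path between the ends of e that uses e is e itself.
    path-through : ∀ {e u v} → Joins G e u v → (r : Walk G v u) → IsPath r →
                   e ∈ walkEdges r → parity c r ≡ c e
    path-through j (step e j′ r) (v∉ ∷ ur) (here refl) = lemma j j′
      where
      even : ∀ {w x} (r : Walk G w x) → IsPath r → x ≡ w → c e xor parity c r ≡ c e
      even r ur refl = trans (cong (c e xor_) (closedPath-even r ur)) (xor-identityʳ (c e))
      lemma : Joins G e _ _ → Joins G e _ _ → c e xor parity c r ≡ c e
      lemma (inj₁ (_ , h≡v)) (inj₁ (_ , h≡w)) = ⊥-elim (All.lookup v∉ (here refl) (trans (sym h≡v) h≡w))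
      lemma (inj₁ (t≡u , _)) (inj₂ (t≡w , _)) = even r ur (trans (sym t≡u) t≡w)
      lemma (inj₂ (_ , h≡u)) (inj₁ (_ , h≡w)) = even r ur (trans (sym h≡u) h≡w)
      lemma (inj₂ (t≡v , _)) (inj₂ (t≡w , _)) = ⊥-elim (All.lookup v∉ (here refl) (trans (sym t≡v) t≡w))
    path-through j (step e j′ r) (v∉ ∷ ur) (there e∈r) with ends∈ r e∈r | j
    ... | t∈ , h∈ | inj₁ (refl , refl) = ⊥-elim (All.lookup v∉ h∈ refl)
    ... | t∈ , h∈ | inj₂ (refl , refl) = ⊥-elim (All.lookup v∉ t∈ refl)

    -- Erasing a loop removes a closed walk e, r with r a path; as T has no cycle,
    -- r can only be e walked backwards.
    erase : ∀ {u v} (p : Walk G u v) → All InTree (walkEdges p) →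
            Σ (PathIn InTree u v) λ (q , _) → parity c p ≡ parity c q
    erase nil [] = (nil , [] ∷ [] , []) , refl
    erase (step {u} {v} e j p) (pe ∷ ps) with erase p ps
    ... | (q , uq , qs) , p≡q with any? (u ≟_) (walkVertices q)
    ...   | no u∉  = (step e j q , ¬Any⇒All¬ _ u∉ ∷ uq , pe ∷ qs) , cong (c e xor_) p≡q
    ...   | yes u∈ = (after , after-path , after-tree) , even
      where
      open Split (split q uq qs u∈)
      open ≡-Reasoning

      before≡e : parity c before ≡ c e
      -- Edges come without decidable equality, so the case distinction is on parities instead of on
      -- whether `before` uses `e`. If the parities differ, `path-through` shows that `before`
      -- avoids `e`, and the two close up to a cycle in T.
      before≡e with parity c before Bool.≟ c e
      ... | yes eq = eq
      ... | no neq = ⊥-elim (acyclic (step e j before)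
        ( z<s
        , before-path
        , ¬Any⇒All¬ _ (λ e∈ → neq (path-through j before before-path e∈))
            ∷ path-edges-unique before before-path
        ) (pe ∷ before-tree))

      even : c e xor parity c p ≡ parity c after
      even = begin
        c e xor parity c p                         ≡⟨ cong (c e xor_) (trans p≡q parity-split) ⟩
        c e xor (parity c before xor parity c after) ≡⟨ sym (xor-assoc (c e) (parity c before) (parity c after)) ⟩
        (c e xor parity c before) xor parity c after ≡⟨ cong (_xor parity c after) (trans (cong (c e xor_) before≡e) (xor-same (c e))) ⟩
        parity c after ∎

    closed-even : ∀ {u} (p : TreeWalk u u) → par p ≡ false
    closed-even (p , ps) = let (q , uq , _) , p≡q = erase p ps in trans p≡q (closedPath-even q uq)

    potential : V → V → Bool
    potential o v = par (connected o v)

    -- Going from `o` to `u` in T, along `p`, and back from `v` to `o` is a closed walk in T, hence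
    -- even.
    parity-potential : ∀ o {u v} (p : TreeWalk u v) → par p ≡ potential o u xor potential o v
    parity-potential o {u} {v} p = solve (par p) (potential o u) (potential o v) (begin
      potential o u xor (par p xor potential o v)
        ≡⟨ cong (λ b → potential o u xor (par p xor b)) (parity-reverse (connected o v)) ⟨
      potential o u xor (par p xor par (reverse (connected o v)))
        ≡⟨ cong (potential o u xor_) (parity-⊕ p _) ⟨
      potential o u xor par (p ⊕ reverse (connected o v))
        ≡⟨ parity-⊕ (connected o u) _ ⟨
      par (connected o u ⊕ p ⊕ reverse (connected o v))
        ≡⟨ closed-even (connected o u ⊕ p ⊕ reverse (connected o v)) ⟩
      false ∎)
      where
      open ≡-Reasoning
      solve : ∀ x y z → y xor (x xor z) ≡ false → x ≡ y xor z
      solve false false false _ = refl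
      solve false true  true  _ = refl
      solve true  false true  _ = refl
      solve true  true  false _ = refl

    -- The crossing parity of the closed walk that `e` forms with any walk of T between its ends. It
    -- is `true` only for edges outside T, and then says that the fundamental cycle is odd.
    potential-jump : V → E → Bool
    potential-jump o e = c e xor (potential o (tail e) xor potential o (head e))

    jump⇒∉tree : ∀ o e → potential-jump o e ≡ true → ¬ InTree e
    jump⇒∉tree o e odd e∈T with trans (sym odd) even
      where
      e-walk : TreeWalk (tail e) (head e)
      e-walk = step e (inj₁ (refl , refl)) nil , e∈T ∷ []
      even : potential-jump o e ≡ false
      even = trans (cong (c e xor_) (trans (sym (parity-potential o e-walk)) (xor-identityʳ (c e)))) (xor-same (c e))
    ... | ()

    jump⇒odd : ∀ o e (p : TreeWalk (head e) (tail e)) → potential-jump o e ≡ true → c e xor par p ≡ true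
    jump⇒odd o e p odd = trans (cong (c e xor_)
      (trans (parity-potential o p) (xor-comm (potential o (head e)) (potential o (tail e))))) odd

module _ where
  open import Data.Nat using (_+_; _*_; _≤_)

  -- Squares in the grid

  Lipschitz : (G : Graph) → (Graph.V G → ℕ) → Set
  Lipschitz G h = ∀ e → h (tail e) ≤ suc (h (head e)) × h (head e) ≤ suc (h (tail e))
    where open Graph G

  module _ {G : Graph} (h : Graph.V G → ℕ) (lip : Lipschitz G h) where
    open Graph G

    walk-Lipschitz : ∀ {u v x} (p : Walk G u v) → x ∈ walkVertices p →
                     h u ≤ walkLength p + h x × h x ≤ walkLength p + h u
    walk-Lipschitz p (here refl) = m≤n+m _ (walkLength p) , m≤n+m _ (walkLength p)
    walk-Lipschitz {u} {v} {x} (step {v = w} e j p) (there x∈) =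
      let w≤ , x≤ = walk-Lipschitz p x∈
          u≤w , w≤u = edge j
      in ≤-trans u≤w (s≤s w≤)
       , ≤-trans x≤ (≤-trans (+-monoʳ-≤ (walkLength p) w≤u) (≤-reflexive (+-suc (walkLength p) (h u))))
      where
      edge : Joins G e u w → h u ≤ suc (h w) × h w ≤ suc (h u)
      edge (inj₁ (refl , refl)) = lip e
      edge (inj₂ (refl , refl)) = proj₂ (lip e) , proj₁ (lip e)

  module _ {G : Graph} (T : SpanningTree G) where
    open Graph G
    open SpanningTree T

    -- The length of the fundamental cycle of e, and 0 for the edges of T.
    cycleLengthAt : E → ℕ
    cycleLengthAt e = maybe′ (λ (e , e∉T) → cycleLength (fundamentalCycle T e e∉T)) 0
                        (Maybe.map (e ,_) (dec⇒maybe (¬? (inTree? e))))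

    -- The fundamental cycle is this tree path together with `e`; its length is the same for every
    -- proof of `¬ InTree e`.
    treeDistance<cycleLengthAt : ∀ e → ¬ InTree e →
      walkLength (proj₁ (treePath T (head e) (tail e))) < cycleLengthAt e
    treeDistance<cycleLengthAt e e∉T with inTree? e
    ... | yes e∈T = ⊥-elim (e∉T e∈T)
    ... | no  _   = ≤-refl

    -- The height is compared with that of `head e` because the tree path in the fundamental cycle
    -- starts there.
    FarEnd : (V → ℕ) → ℕ → E → E → Set
    FarEnd h j e e′ = ∃ λ x → (x ≡ tail e′ ⊎ x ≡ head e′) ×
                              (j + h x < h (head e) ⊎ j + h (head e) < h x)

    -- An odd path uses some edge marked by `c`. It therefore visits the far end of that edge, which
    -- takes more than `j` steps because `h` changes by at most one along each edge.
    odd-treePath⇒long : (c : E → Bool) (h : V → ℕ) → Lipschitz G h →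
      ∀ j e → ¬ InTree e → parity c (proj₁ (treePath T (head e) (tail e))) ≡ true →
      (∀ e′ → c e′ ≡ true → FarEnd h j e e′) →
      j < cycleLengthAt e
    odd-treePath⇒long c h lip j e e∉T odd far =
      let e′ , e′∈p , ce′ = parity-odd⇒∃ c p odd
          x , x-end , x-far = far e′ ce′
      in <-trans (distance (walk-Lipschitz h lip p (end∈p e′∈p x-end)) x-far) (treeDistance<cycleLengthAt e e∉T)
      where
      p = proj₁ (treePath T (head e) (tail e))
      end∈p : ∀ {e′ x} → e′ ∈ walkEdges p → x ≡ tail e′ ⊎ x ≡ head e′ → x ∈ walkVertices p
      end∈p e′∈p (inj₁ refl) = proj₁ (ends∈ p e′∈p)
      end∈p e′∈p (inj₂ refl) = proj₂ (ends∈ p e′∈p)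
      distance : ∀ {x y l} → x ≤ l + y × y ≤ l + x →
                 j + y < x ⊎ j + x < y → j < l
      distance {y = y} (x≤ , _) (inj₁ <x) = +-cancelʳ-< y j _ (≤-trans <x x≤)
      distance {x = x} (_ , y≤) (inj₂ <y) = +-cancelʳ-< x j _ (≤-trans <y y≤)

  -- Coordinates are natural numbers, so that squares are translated by addition and counted by `∑`.
  -- Values beyond the range are sent to the last element.
  clamp : ∀ {n} → ℕ → Fin (suc n)
  clamp {zero}  _       = zero
  clamp {suc n} zero    = zero
  clamp {suc n} (suc x) = suc (clamp x)

  toℕ-clamp : ∀ {n x} → x ≤ n → toℕ (clamp {n} x) ≡ x
  toℕ-clamp {zero}  z≤n       = refl
  toℕ-clamp {suc n} z≤n       = refl
  toℕ-clamp {suc n} (s≤s x≤n) = cong suc (toℕ-clamp x≤n)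

  inject₁-clamp : ∀ {n x} → x ≤ n → inject₁ (clamp {n} x) ≡ clamp x
  inject₁-clamp {zero}  z≤n       = refl
  inject₁-clamp {suc n} z≤n       = refl
  inject₁-clamp {suc n} (s≤s x≤n) = cong suc (inject₁-clamp x≤n)

  -- Meant for one side of a ring: either the potential jumps at some edge of the side, or it agrees
  -- at the two corners.
  change-or-equal : ∀ w (f : ℕ → Bool) →
    (∃ λ t → t < w × f t xor f (suc t) ≡ true) ⊎ f 0 ≡ f w
  change-or-equal zero f = inj₂ refl
  change-or-equal (suc w) f with f 0 xor f 1 in eq | change-or-equal w (λ t → f (suc t))
  ... | true  | _ = inj₁ (0 , z<s , eq)
  ... | false | inj₁ (t , t<w , odd) = inj₁ (suc t , s≤s t<w , odd)
  ... | false | inj₂ f1≡fw = inj₂ (trans (xor≡false⇒≡ eq) f1≡fw)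
    where
    xor≡false⇒≡ : ∀ {x y} → x xor y ≡ false → x ≡ y
    xor≡false⇒≡ {false} {false} _ = refl
    xor≡false⇒≡ {true}  {true}  _ = refl

  <ᵇ-xor-suc : ∀ b y → (y ≡ᵇ b) ≡ (b <ᵇ y) xor (b <ᵇ suc y)
  <ᵇ-xor-suc zero    zero    = refl
  <ᵇ-xor-suc zero    (suc y) = refl
  <ᵇ-xor-suc (suc b) zero    = refl
  <ᵇ-xor-suc (suc b) (suc y) = <ᵇ-xor-suc b y

  <ᵇ-false : ∀ {k l} → l ≤ k → (k <ᵇ l) ≡ false
  <ᵇ-false z≤n       = refl
  <ᵇ-false (s≤s l≤k) = <ᵇ-false l≤k

  <ᵇ-true : ∀ {k l} → k < l → (k <ᵇ l) ≡ true
  <ᵇ-true {zero}  (s≤s _)           = refl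
  <ᵇ-true {suc k} (s≤s k<l@(s≤s _)) = <ᵇ-true k<l

  module _ (m : ℕ) where
    open Graph (grid (suc (suc m)))

    hEdge vEdge : ℕ → ℕ → E
    hEdge x y = inj₁ (clamp x , clamp y)
    vEdge x y = inj₂ (clamp x , clamp y)

    vertex : ℕ → ℕ → V
    vertex x y = clamp x , clamp y

    X Y : V → ℕ
    X (x , _) = toℕ x
    Y (_ , y) = toℕ y

    private
      inject₁-Lipschitz : ∀ {n} (i : Fin n) → toℕ (inject₁ i) ≤ suc (suc (toℕ i)) × suc (toℕ i) ≤ suc (toℕ (inject₁ i))
      inject₁-Lipschitz i = ≤-trans (≤-reflexive (toℕ-inject₁ i)) (≤-trans (n≤1+n _) (n≤1+n _))
                          , s≤s (≤-reflexive (sym (toℕ-inject₁ i)))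

    X-Lipschitz : Lipschitz (grid (suc (suc m))) X
    X-Lipschitz (inj₁ (i , _)) = inject₁-Lipschitz i
    X-Lipschitz (inj₂ _)       = n≤1+n _ , n≤1+n _

    Y-Lipschitz : Lipschitz (grid (suc (suc m))) Y
    Y-Lipschitz (inj₁ _)       = n≤1+n _ , n≤1+n _
    Y-Lipschitz (inj₂ (_ , i)) = inject₁-Lipschitz i

    -- The edges crossed by the horizontal rays to the right and to the left of the
    -- midpoint of the unit square with lower left corner (a , b).
    crossesRight crossesLeft : ℕ → ℕ → E → Bool
    crossesRight a b (inj₁ _)       = false
    crossesRight a b (inj₂ (x , y)) = (a <ᵇ toℕ x) ∧ (toℕ y ≡ᵇ b)
    crossesLeft  a b (inj₁ _)       = false
    crossesLeft  a b (inj₂ (x , y)) = not (a <ᵇ toℕ x) ∧ (toℕ y ≡ᵇ b)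

    above : ℕ → V → Bool
    above b v = b <ᵇ Y v

    -- The two rays together make up a full horizontal line between heights `b` and `b + 1`, and an
    -- edge crosses it exactly when one of its ends is `above` and the other is not.
    crosses-coboundary : ∀ a b e →
      crossesLeft a b e xor crossesRight a b e ≡ above b (tail e) xor above b (head e)
    crosses-coboundary a b (inj₁ (x , y)) = sym (xor-same (b <ᵇ toℕ y))
    crosses-coboundary a b (inj₂ (x , y)) = begin
      (not (a <ᵇ toℕ x) ∧ (toℕ y ≡ᵇ b)) xor ((a <ᵇ toℕ x) ∧ (toℕ y ≡ᵇ b)) ≡⟨ either (a <ᵇ toℕ x) (toℕ y ≡ᵇ b) ⟩
      (toℕ y ≡ᵇ b)                                     ≡⟨ <ᵇ-xor-suc b (toℕ y) ⟩
      (b <ᵇ toℕ y) xor (b <ᵇ suc (toℕ y))              ≡⟨ cong (λ z → (b <ᵇ z) xor (b <ᵇ suc (toℕ y))) (toℕ-inject₁ y) ⟨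
      (b <ᵇ toℕ (inject₁ y)) xor (b <ᵇ suc (toℕ y))    ∎
      where
      open ≡-Reasoning
      either : ∀ r s → (not r ∧ s) xor (r ∧ s) ≡ s
      either false false = refl
      either false true  = refl
      either true  s     = refl

    crossesRight⇒ : ∀ {a b x y} → crossesRight a b (inj₂ (x , y)) ≡ true → a < toℕ x × toℕ y ≡ b
    crossesRight⇒ {a} {b} {x} {y} eq with a <ᵇ toℕ x in lt | toℕ y ≡ᵇ b in eqb
    ... | true | true = <ᵇ⇒< a (toℕ x) (≡true⇒T lt) , ≡ᵇ⇒≡ (toℕ y) b (≡true⇒T eqb)
      where
      ≡true⇒T : ∀ {x} → x ≡ true → Bool.T x
      ≡true⇒T refl = _

    crossesLeft⇒ : ∀ {a b x y} → crossesLeft a b (inj₂ (x , y)) ≡ true → toℕ x ≤ a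
    crossesLeft⇒ {a} {b} {x} {y} eq with a <ᵇ toℕ x in lt
    ... | false = ≮⇒≥ (λ a<x → subst Bool.T lt (<⇒<ᵇ a<x))

    -- The ring is the boundary of the square of side w = 2j + 1 with lower left corner (p , q);
    -- the rays start in its central unit square.
    module _ (T : SpanningTree (grid (suc (suc m)))) {p q j : ℕ}
             (p+w≤ : suc (j + j) + p ≤ suc m) (q+w≤ : suc (j + j) + q ≤ suc m) where
      private
        w a b : ℕ
        w = suc (j + j)
        a = j + p
        b = j + q

        c : E → Bool
        c = crossesRight a b

        φ : ℕ → ℕ → Bool
        φ x y = potential T c (vertex 0 0) (vertex x y)

        jump : E → Bool
        jump = potential-jump T c (vertex 0 0)

        pathBack : ∀ e → TreeWalk T (head e) (tail e)
        pathBack e = let π , _ , π⊆T = treePath T (head e) (tail e) in π , π⊆T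

        p≤ : p ≤ suc m
        p≤ = ≤-trans (m≤n+m p w) p+w≤

        q≤ : q ≤ suc m
        q≤ = ≤-trans (m≤n+m q w) q+w≤

        inside : ∀ {t r} → w + r ≤ suc m → t < w → t + r ≤ m
        inside {r = r} w+r≤ t<w = ≤-pred (≤-trans (+-monoˡ-≤ r t<w) w+r≤)

        a<w+p : a < w + p
        a<w+p = s≤s (+-monoˡ-≤ p (m≤m+n j j))

        b<w+q : b < w + q
        b<w+q = s≤s (+-monoˡ-≤ q (m≤m+n j j))

        hJump : ∀ {x} y → x ≤ m → jump (hEdge x y) ≡ φ x y xor φ (suc x) y
        hJump {x} y x≤m rewrite inject₁-clamp x≤m = refl

        vJump : ∀ x {y} → y ≤ m → jump (vEdge x y) ≡ c (vEdge x y) xor (φ x y xor φ x (suc y))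
        vJump x {y} y≤m rewrite inject₁-clamp y≤m = refl

        leftSide-uncrossed : ∀ y → c (vEdge p y) ≡ false
        leftSide-uncrossed y rewrite toℕ-clamp p≤ | <ᵇ-false (m≤n+m p j) = refl

        rightSide-crossed : ∀ {y} → y ≤ m → c (vEdge (w + p) y) ≡ (b <ᵇ y) xor (b <ᵇ suc y)
        rightSide-crossed {y} y≤m rewrite toℕ-clamp p+w≤ | <ᵇ-true a<w+p | toℕ-clamp y≤m = <ᵇ-xor-suc b y

        leftJump : ∀ {y} → y ≤ m → jump (vEdge p y) ≡ φ p y xor φ p (suc y)
        leftJump {y} y≤m = trans (vJump p y≤m)
          (cong (_xor (φ p y xor φ p (suc y))) (leftSide-uncrossed y))

        -- The right side meets the ray at height `b`. Adding `b <ᵇ y` to the potential absorbs this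
        -- crossing, so that the jump becomes a difference of consecutive values and
        -- `change-or-equal` applies.
        rightJump : ∀ {y} → y ≤ m → jump (vEdge (w + p) y) ≡
          (φ (w + p) y xor (b <ᵇ y)) xor (φ (w + p) (suc y) xor (b <ᵇ suc y))
        rightJump {y} y≤m = trans (vJump (w + p) y≤m) (trans
          (cong (_xor (φ (w + p) y xor φ (w + p) (suc y))) (rightSide-crossed y≤m))
          (xor-interchange (b <ᵇ y) (b <ᵇ suc y) (φ (w + p) y) (φ (w + p) (suc y))))

        rightSide-uncrossedLeft : ∀ y → crossesLeft a b (vEdge (w + p) y) ≡ false
        rightSide-uncrossedLeft y rewrite toℕ-clamp p+w≤ | <ᵇ-true a<w+p = refl

        odd-pathBack : ∀ e → c e ≡ false → jump e ≡ true → parity c (proj₁ (pathBack e)) ≡ true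
        odd-pathBack e ce odd with jump⇒odd T c (vertex 0 0) e (pathBack e) odd
        ... | eq rewrite ce = eq

        -- A closed walk crosses the line formed by both rays an even number of times. So a cycle
        -- that is odd for the right ray is odd for the left ray too, and `e` itself contributes
        -- nothing there.
        odd-pathBackLeft : ∀ e → crossesLeft a b e ≡ false → jump e ≡ true →
                           parity (crossesLeft a b) (proj₁ (pathBack e)) ≡ true
        odd-pathBackLeft e le odd = solve (crossesLeft a b e) (c e) _ _ le
          (jump⇒odd T c (vertex 0 0) e (pathBack e) odd) (begin
            parity (crossesLeft a b) π xor parity c π      ≡⟨ parity-xor (crossesLeft a b) c π ⟨
            parity (λ e′ → crossesLeft a b e′ xor c e′) π ≡⟨ parity-coboundary _ (above b) (crosses-coboundary a b) π ⟩
            above b (head e) xor above b (tail e)          ≡⟨ xor-comm (above b (head e)) (above b (tail e)) ⟩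
            above b (tail e) xor above b (head e)          ≡⟨ crosses-coboundary a b e ⟨
            crossesLeft a b e xor c e                      ∎)
          where
          open ≡-Reasoning
          π = proj₁ (pathBack e)
          solve : ∀ x y u v → x ≡ false → y xor v ≡ true → u xor v ≡ x xor y → u ≡ true
          solve false y     true  v     _ _ _ = refl
          solve false false false false _ () _
          solve false false false true  _ _ ()
          solve false true  false false _ _ ()
          solve false true  false true  _ () _

        -- Which end of a crossed edge is taken matters by one: its upper end has height `b + 1`,
        -- that is `j + 1` above the bottom side, while for the top side the lower end, at height
        -- `b`, is `j + 1` below.
        bottom-long : ∀ {x} → jump (hEdge x q) ≡ true → j < cycleLengthAt T (hEdge x q)
        bottom-long {x} odd =
          odd-treePath⇒long T c Y Y-Lipschitz j e (jump⇒∉tree T c _ e odd) (odd-pathBack e refl odd) far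
          where
          e = hEdge x q
          far : ∀ e′ → c e′ ≡ true → FarEnd T Y j e e′
          far e′@(inj₂ (g , i)) ce′ with crossesRight⇒ {a} {b} {g} {i} ce′
          ... | _ , i≡b = head e′ , inj₂ refl , inj₂ (s≤s (≤-reflexive (trans (cong (j +_) (toℕ-clamp q≤)) (sym i≡b))))

        top-long : ∀ {x} → jump (hEdge x (w + q)) ≡ true → j < cycleLengthAt T (hEdge x (w + q))
        top-long {x} odd =
          odd-treePath⇒long T c Y Y-Lipschitz j e (jump⇒∉tree T c _ e odd) (odd-pathBack e refl odd) far
          where
          e = hEdge x (w + q)
          far : ∀ e′ → c e′ ≡ true → FarEnd T Y j e e′
          far e′@(inj₂ (g , i)) ce′ with crossesRight⇒ {a} {b} {g} {i} ce′
          ... | _ , i≡b = tail e′ , inj₁ refl , inj₁ (≤-reflexive (begin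
            suc (j + toℕ (inject₁ i)) ≡⟨ cong (λ z → suc (j + z)) (trans (toℕ-inject₁ i) i≡b) ⟩
            suc (j + (j + q))       ≡⟨ cong suc (+-assoc j j q) ⟨
            w + q                     ≡⟨ toℕ-clamp q+w≤ ⟨
            toℕ (clamp (w + q))       ∎))
            where open ≡-Reasoning

        left-long : ∀ {y} → jump (vEdge p y) ≡ true → j < cycleLengthAt T (vEdge p y)
        left-long {y} odd =
          odd-treePath⇒long T c X X-Lipschitz j e (jump⇒∉tree T c _ e odd) (odd-pathBack e (leftSide-uncrossed y) odd) far
          where
          e = vEdge p y
          far : ∀ e′ → c e′ ≡ true → FarEnd T X j e e′
          far e′@(inj₂ (g , i)) ce′ with crossesRight⇒ {a} {b} {g} {i} ce′
          ... | a<g , _ = tail e′ , inj₁ refl , inj₂ (≤-trans (≤-reflexive (cong (λ z → suc (j + z)) (toℕ-clamp p≤))) a<g)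

        -- Edges on the right ray can be close to the right side, so the left ray is used: its edges
        -- lie in columns up to `a`, at least `j + 1` away from column `w + p`.
        right-long : ∀ {y} → jump (vEdge (w + p) y) ≡ true → j < cycleLengthAt T (vEdge (w + p) y)
        right-long {y} odd =
          odd-treePath⇒long T (crossesLeft a b) X X-Lipschitz j e (jump⇒∉tree T c _ e odd)
            (odd-pathBackLeft e (rightSide-uncrossedLeft y) odd) far
          where
          e = vEdge (w + p) y
          far : ∀ e′ → crossesLeft a b e′ ≡ true → FarEnd T X j e e′
          far e′@(inj₂ (g , i)) le′ = tail e′ , inj₁ refl , inj₁ (begin
            suc (j + toℕ g)     ≤⟨ s≤s (+-monoʳ-≤ j (crossesLeft⇒ {a} {b} {g} {i} le′)) ⟩
            suc (j + (j + p)) ≡⟨ cong suc (+-assoc j j p) ⟨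
            w + p               ≡⟨ toℕ-clamp p+w≤ ⟨
            toℕ (clamp (w + p)) ∎)
            where open ≤-Reasoning

      ring-has-long : ∃ λ t → t < w ×
        ( j < cycleLengthAt T (hEdge (t + p) q) ⊎ j < cycleLengthAt T (hEdge (t + p) (w + q))
        ⊎ j < cycleLengthAt T (vEdge p (t + q)) ⊎ j < cycleLengthAt T (vEdge (w + p) (t + q)) )
      ring-has-long with
          change-or-equal w (λ t → φ (t + p) q)
        | change-or-equal w (λ t → φ (t + p) (w + q))
        | change-or-equal w (λ t → φ p (t + q))
        | change-or-equal w (λ t → φ (w + p) (t + q) xor (b <ᵇ t + q))
      ... | inj₁ (t , t<w , odd) | _ | _ | _ =
        t , t<w , inj₁ (bottom-long (trans (hJump q (inside p+w≤ t<w)) odd))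
      ... | inj₂ _ | inj₁ (t , t<w , odd) | _ | _ =
        t , t<w , inj₂ (inj₁ (top-long (trans (hJump (w + q) (inside p+w≤ t<w)) odd)))
      ... | inj₂ _ | inj₂ _ | inj₁ (t , t<w , odd) | _ =
        t , t<w , inj₂ (inj₂ (inj₁ (left-long
          (trans (leftJump (inside q+w≤ t<w)) odd))))
      ... | inj₂ _ | inj₂ _ | inj₂ _ | inj₁ (t , t<w , odd) =
        t , t<w , inj₂ (inj₂ (inj₂ (right-long (trans (rightJump (inside q+w≤ t<w)) odd))))
      -- Without a jump, the bottom, left and top sides make `φ` equal at the two right corners,
      -- whereas the single crossing of the right side makes it differ there.
      ... | inj₂ bottom | inj₂ top | inj₂ left | inj₂ right = ⊥-elim (odd-total
        (trans (sym bottom) (trans left top))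
        (subst₂ (λ x y → φ (w + p) q xor x ≡ φ (w + p) (w + q) xor y)
          (<ᵇ-false (m≤n+m q j)) (<ᵇ-true b<w+q) right))
        where
        odd-total : ∀ {x y} → x ≡ y → ¬ x xor false ≡ y xor true
        odd-total {false} refl ()
        odd-total {true}  refl ()

  -- Double counting

  ∑ : ℕ → (ℕ → ℕ) → ℕ
  ∑ zero    f = 0
  ∑ (suc n) f = f 0 + ∑ n (f ∘ suc)

  ∑-mono : ∀ n {f g} → (∀ i → i < n → f i ≤ g i) → ∑ n f ≤ ∑ n g
  ∑-mono zero    f≤g = z≤n
  ∑-mono (suc n) f≤g = +-mono-≤ (f≤g 0 z<s) (∑-mono n (λ i i<n → f≤g (suc i) (s≤s i<n)))

  ∑-cong : ∀ n {f g} → (∀ i → f i ≡ g i) → ∑ n f ≡ ∑ n g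
  ∑-cong zero    f≡g = refl
  ∑-cong (suc n) f≡g = cong₂ _+_ (f≡g 0) (∑-cong n (f≡g ∘ suc))

  ∑-const : ∀ n k → ∑ n (λ _ → k) ≡ n * k
  ∑-const zero    k = refl
  ∑-const (suc n) k = cong (k +_) (∑-const n k)

  ∑-* : ∀ n k f → ∑ n (λ i → k * f i) ≡ k * ∑ n f
  ∑-* zero    k f = sym (*-zeroʳ k)
  ∑-* (suc n) k f = trans (cong (k * f 0 +_) (∑-* n k (f ∘ suc))) (sym (*-distribˡ-+ k (f 0) (∑ n (f ∘ suc))))

  ∑-+ : ∀ n f g → ∑ n (λ i → f i + g i) ≡ ∑ n f + ∑ n g
  ∑-+ zero    f g = refl
  ∑-+ (suc n) f g = trans (cong (f 0 + g 0 +_) (∑-+ n (f ∘ suc) (g ∘ suc)))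
                          (interchange (f 0) (g 0) (∑ n (f ∘ suc)) (∑ n (g ∘ suc)))
    where
    interchange : ∀ a b c d → a + b + (c + d) ≡ a + c + (b + d)
    interchange = solve-∀

  ∑-swap : ∀ m n (f : ℕ → ℕ → ℕ) → ∑ m (λ i → ∑ n (f i)) ≡ ∑ n (λ j → ∑ m (λ i → f i j))
  ∑-swap zero    n f = sym (trans (∑-const n 0) (*-zeroʳ n))
  ∑-swap (suc m) n f = trans (cong (∑ n (f 0) +_) (∑-swap m n (f ∘ suc)))
                             (sym (∑-+ n (f 0) (λ j → ∑ m (λ i → f (suc i) j))))

  ∑-split : ∀ k n f → ∑ (k + n) f ≡ ∑ k f + ∑ n (λ i → f (k + i))
  ∑-split zero    n f = refl
  ∑-split (suc k) n f = trans (cong (f 0 +_) (∑-split k n (f ∘ suc))) (sym (+-assoc (f 0) _ _))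

  ∑-shift : ∀ {k n N} → k + n ≤ N → ∀ f → ∑ n (λ i → f (k + i)) ≤ ∑ N f
  ∑-shift {k} {n} {N} k+n≤N f = begin
    ∑ n (λ i → f (k + i))                      ≤⟨ m≤n+m _ (∑ k f) ⟩
    ∑ k f + ∑ n (λ i → f (k + i))              ≡⟨ ∑-split k n f ⟨
    ∑ (k + n) f                                ≤⟨ m≤m+n _ _ ⟩
    ∑ (k + n) f + ∑ (N ∸ (k + n)) (λ i → f (k + n + i)) ≡⟨ ∑-split (k + n) (N ∸ (k + n)) f ⟨
    ∑ (k + n + (N ∸ (k + n))) f                ≡⟨ cong (λ z → ∑ z f) (m+[n∸m]≡n k+n≤N) ⟩
    ∑ N f                                      ∎
    where open ≤-Reasoning

  ∑∑-shift : ∀ {k l n M N} → k + n ≤ M → l + n ≤ N → ∀ (f : ℕ → ℕ → ℕ) →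
             ∑ n (λ p → ∑ n (λ q → f (k + p) (l + q))) ≤ ∑ M (λ x → ∑ N (f x))
  ∑∑-shift {k} {l} {n} {M} {N} k+n≤M l+n≤N f =
    ≤-trans (∑-mono n (λ p _ → ∑-shift {l} l+n≤N (f (k + p)))) (∑-shift {k} k+n≤M (λ x → ∑ N (f x)))

  term≤∑ : ∀ {n i} → i < n → ∀ f → f i ≤ ∑ n f
  term≤∑ {suc n} {zero}  _         f = m≤m+n (f 0) _
  term≤∑ {suc n} {suc i} (s≤s i<n) f = ≤-trans (term≤∑ i<n (f ∘ suc)) (m≤n+m _ (f 0))

  -- Every position `(p , q)` of the ring contributes at least 1 to the sum over its edges. For a
  -- fixed offset `t`, the edge at `t` on each of the four sides runs through a translated `s` by
  -- `s` box, without repetition, as `(p , q)` varies. Hence each offset costs at most the total of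
  -- `H` twice and that of `V` twice.
  ring-count : ∀ (H V : ℕ → ℕ → ℕ) s w N → w + s ≤ N →
    (∀ p q → p < s → q < s → ∃ λ t → t < w ×
       (1 ≤ H (t + p) q ⊎ 1 ≤ H (t + p) (w + q) ⊎ 1 ≤ V p (t + q) ⊎ 1 ≤ V (w + p) (t + q))) →
    s * s ≤ w * (2 * (∑ N (λ x → ∑ (suc N) (H x)) + ∑ (suc N) (λ x → ∑ N (V x))))
  ring-count H V s w N w+s≤N hit = begin
    s * s                                        ≡⟨ cong (s *_) (*-identityʳ s) ⟨
    s * (s * 1)                                  ≡⟨ cong (s *_) (∑-const s 1) ⟨
    s * ∑ s (λ _ → 1)                            ≡⟨ ∑-const s _ ⟨
    ∑ s (λ p → ∑ s (λ q → 1))                    ≤⟨ ∑-mono s (λ p p<s → ∑-mono s (λ q q<s → one≤ p q (hit p q p<s q<s))) ⟩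
    ∑ s (λ p → ∑ s (λ q → ∑ w (λ t → F t p q)))  ≡⟨ ∑-cong s (λ p → ∑-swap s w (λ q t → F t p q)) ⟩
    ∑ s (λ p → ∑ w (λ t → ∑ s (λ q → F t p q)))  ≡⟨ ∑-swap s w (λ p t → ∑ s (F t p)) ⟩
    ∑ w (λ t → ∑ s (λ p → ∑ s (λ q → F t p q)))  ≤⟨ ∑-mono w bound ⟩
    ∑ w (λ _ → 2 * (ΣH + ΣV))                    ≡⟨ ∑-const w _ ⟩
    w * (2 * (ΣH + ΣV))                          ∎
    where
    open ≤-Reasoning
    ΣH = ∑ N (λ x → ∑ (suc N) (H x))
    ΣV = ∑ (suc N) (λ x → ∑ N (V x))

    F : ℕ → ℕ → ℕ → ℕ
    F t p q = (H (t + p) q + H (t + p) (w + q)) + (V p (t + q) + V (w + p) (t + q))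

    one≤ : ∀ p q → (∃ λ t → t < w × (1 ≤ H (t + p) q ⊎ 1 ≤ H (t + p) (w + q) ⊎ 1 ≤ V p (t + q) ⊎ 1 ≤ V (w + p) (t + q))) →
           1 ≤ ∑ w (λ t → F t p q)
    one≤ p q (t , t<w , long) = ≤-trans (side long) (term≤∑ t<w (λ t → F t p q))
      where
      side : 1 ≤ H (t + p) q ⊎ 1 ≤ H (t + p) (w + q) ⊎ 1 ≤ V p (t + q) ⊎ 1 ≤ V (w + p) (t + q) → 1 ≤ F t p q
      side (inj₁ 1≤)               = m≤n⇒m≤n+o _ (m≤n⇒m≤n+o _ 1≤)
      side (inj₂ (inj₁ 1≤))        = m≤n⇒m≤n+o _ (m≤n⇒m≤o+n (H (t + p) q) 1≤)
      side (inj₂ (inj₂ (inj₁ 1≤))) = m≤n⇒m≤o+n (H (t + p) q + H (t + p) (w + q)) (m≤n⇒m≤n+o _ 1≤)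
      side (inj₂ (inj₂ (inj₂ 1≤))) = m≤n⇒m≤o+n (H (t + p) q + H (t + p) (w + q)) (m≤n⇒m≤o+n (V p (t + q)) 1≤)

    ∑∑-+ : ∀ (f g : ℕ → ℕ → ℕ) → ∑ s (λ p → ∑ s (λ q → f p q + g p q)) ≡ ∑ s (λ p → ∑ s (f p)) + ∑ s (λ p → ∑ s (g p))
    ∑∑-+ f g = trans (∑-cong s (λ p → ∑-+ s (f p) (g p))) (∑-+ s _ _)

    bound : ∀ t → t < w → ∑ s (λ p → ∑ s (F t p)) ≤ 2 * (ΣH + ΣV)
    bound t t<w = begin
      ∑ s (λ p → ∑ s (F t p)) ≡⟨ ∑∑-+ (λ p q → H (t + p) q + H (t + p) (w + q)) (λ p q → V p (t + q) + V (w + p) (t + q)) ⟩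
      _ ≡⟨ cong₂ _+_ (∑∑-+ (λ p q → H (t + p) q) (λ p q → H (t + p) (w + q)))
                     (∑∑-+ (λ p q → V p (t + q)) (λ p q → V (w + p) (t + q))) ⟩
      _ ≤⟨ +-mono-≤ (+-mono-≤ (∑∑-shift {t} {0} t+s≤N s≤sN H) (∑∑-shift {t} {w} t+s≤N w+s≤sN H))
                    (+-mono-≤ (∑∑-shift {0} {t} s≤sN t+s≤N V) (∑∑-shift {w} {t} w+s≤sN t+s≤N V)) ⟩
      ΣH + ΣH + (ΣV + ΣV) ≡⟨ double ΣH ΣV ⟩
      2 * (ΣH + ΣV) ∎
      where
      t+s≤N : t + s ≤ N
      t+s≤N = ≤-trans (+-monoˡ-≤ s (<⇒≤ t<w)) w+s≤N
      w+s≤sN : w + s ≤ suc N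
      w+s≤sN = m≤n⇒m≤1+n w+s≤N
      s≤sN : s ≤ suc N
      s≤sN = ≤-trans (m≤n+m s w) w+s≤sN
      double : ∀ a b → a + a + (b + b) ≡ 2 * (a + b)
      double = solve-∀

  -- The block from `B` to `5 * B` has `4 * B` terms of size at least `S / (20 * B)`, hence sum at
  -- least `S / 5`. The term at 0 alone is at least `S / 4` and counts as one more block, which
  -- makes the factor `suc K`.
  harmonic : ∀ (g : ℕ → ℕ) S K → (∀ j → j < 5 ^ K → S ≤ 4 * (suc j * g j)) →
             suc K * S ≤ 5 * ∑ (5 ^ K) g
  harmonic g S zero bound = begin
    S + 0               ≡⟨ +-identityʳ S ⟩
    S                   ≤⟨ bound 0 z<s ⟩
    4 * (1 * g 0)       ≤⟨ *-monoˡ-≤ (1 * g 0) (n≤1+n 4) ⟩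
    5 * (1 * g 0)       ≡⟨ cong (5 *_) (trans (*-identityˡ (g 0)) (sym (+-identityʳ (g 0)))) ⟩
    5 * (g 0 + 0)       ∎
    where open ≤-Reasoning
  harmonic g S (suc K) bound = begin
    S + suc K * S                      ≤⟨ +-mono-≤ block (harmonic g S K (λ j j<B → bound j (≤-trans j<B (m≤m+n B (4 * B))))) ⟩
    5 * ∑ (4 * B) (g ∘ (B +_)) + 5 * ∑ B g ≡⟨ trans (+-comm _ (5 * ∑ B g)) (sym (*-distribˡ-+ 5 (∑ B g) _)) ⟩
    5 * (∑ B g + ∑ (4 * B) (g ∘ (B +_)))   ≡⟨ cong (5 *_) (∑-split B (4 * B) g) ⟨
    5 * ∑ (5 * B) g                        ∎
    where
    open ≤-Reasoning
    B = 5 ^ K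
    rearrange : ∀ b y → 4 * (5 * b * y) ≡ 4 * b * (5 * y)
    rearrange = solve-∀
    block : S ≤ 5 * ∑ (4 * B) (g ∘ (B +_))
    block = *-cancelˡ-≤ (4 * B) {{m*n≢0 4 B {{_}} {{m^n≢0 5 K}}}} (begin
      4 * B * S                                         ≡⟨ ∑-const (4 * B) S ⟨
      ∑ (4 * B) (λ _ → S)                               ≤⟨ ∑-mono (4 * B) (λ i i<4B → term (B + i) (+-monoʳ-< B i<4B)) ⟩
      ∑ (4 * B) (λ i → 4 * (5 * B) * g (B + i))         ≡⟨ ∑-* (4 * B) (4 * (5 * B)) (g ∘ (B +_)) ⟩
      4 * (5 * B) * ∑ (4 * B) (g ∘ (B +_))              ≡⟨ *-assoc 4 (5 * B) _ ⟩
      4 * (5 * B * ∑ (4 * B) (g ∘ (B +_)))              ≡⟨ rearrange B (∑ (4 * B) (g ∘ (B +_))) ⟩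
      4 * B * (5 * ∑ (4 * B) (g ∘ (B +_)))              ∎)
      where
      term : ∀ j → j < 5 * B → S ≤ 4 * (5 * B) * g j
      term j j<5B = begin
        S                   ≤⟨ bound j j<5B ⟩
        4 * (suc j * g j)   ≤⟨ *-monoʳ-≤ 4 (*-monoˡ-≤ (g j) j<5B) ⟩
        4 * (5 * B * g j)   ≡⟨ *-assoc 4 (5 * B) (g j) ⟨
        4 * (5 * B) * g j   ∎

  -- From counts of long cycles to the sum of cycle lengths

  exceeds : ℕ → ℕ → ℕ
  exceeds j v = if j <ᵇ v then 1 else 0

  exceeds≥1 : ∀ {j v} → j < v → 1 ≤ exceeds j v
  exceeds≥1 {zero}  (s≤s _)               = ≤-refl
  exceeds≥1 {suc j} (s≤s j<v) = exceeds≥1 j<v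

  -- Layer-cake summation: exactly `v` thresholds lie below `v`, and `J` may cut some of them off.
  ∑-exceeds : ∀ J v → ∑ J (λ j → exceeds j v) ≤ v
  ∑-exceeds zero    v       = z≤n
  ∑-exceeds (suc J) zero    = ≤-reflexive (trans (∑-const J 0) (*-zeroʳ J))
  ∑-exceeds (suc J) (suc v) = s≤s (∑-exceeds J v)

  module _ {A : Set} where

    ∑-sum≤ : ∀ J (f : ℕ → A → ℕ) (g : A → ℕ) → (∀ x → ∑ J (λ j → f j x) ≤ g x) →
             ∀ xs → ∑ J (λ j → sum (map (f j) xs)) ≤ sum (map g xs)
    ∑-sum≤ J f g f≤g []       = ≤-reflexive (trans (∑-const J 0) (*-zeroʳ J))
    ∑-sum≤ J f g f≤g (x ∷ xs) = ≤-trans (≤-reflexive (∑-+ J (λ j → f j x) _))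
                                        (+-mono-≤ (f≤g x) (∑-sum≤ J f g f≤g xs))

    sum-map-mapMaybe : ∀ {B : Set} (f : A → Maybe B) (g : B → ℕ) xs →
                       sum (map g (mapMaybe f xs)) ≡ sum (map (maybe′ g 0 ∘ f) xs)
    sum-map-mapMaybe f g [] = refl
    sum-map-mapMaybe f g (x ∷ xs) with f x
    ... | just y  = cong (g y +_) (sum-map-mapMaybe f g xs)
    ... | nothing = sum-map-mapMaybe f g xs

    sum-map-cartesianProduct : ∀ {B : Set} (f : A × B → ℕ) xs ys →
      sum (map f (cartesianProduct xs ys)) ≡ sum (map (λ x → sum (map (λ y → f (x , y)) ys)) xs)
    sum-map-cartesianProduct f []       ys = refl
    sum-map-cartesianProduct f (x ∷ xs) ys = begin
      sum (map f (map (x ,_) ys ++ cartesianProduct xs ys))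
        ≡⟨ cong sum (map-++ f (map (x ,_) ys) _) ⟩
      sum (map f (map (x ,_) ys) ++ map f (cartesianProduct xs ys))
        ≡⟨ sum-++ (map f (map (x ,_) ys)) _ ⟩
      sum (map f (map (x ,_) ys)) + sum (map f (cartesianProduct xs ys))
        ≡⟨ cong₂ _+_ (cong sum (sym (map-∘ ys))) (sum-map-cartesianProduct f xs ys) ⟩
      _ ∎
      where open ≡-Reasoning

  length-cartesianProduct : ∀ {A B : Set} (xs : List A) (ys : List B) →
                            length (cartesianProduct xs ys) ≡ length xs * length ys
  length-cartesianProduct []       ys = refl
  length-cartesianProduct (x ∷ xs) ys = trans (length-++ (map (x ,_) ys))
    (cong₂ _+_ (length-map (x ,_) ys) (length-cartesianProduct xs ys))

  sum-tabulate : ∀ n (f : Fin (suc n) → ℕ) → sum (tabulate f) ≡ ∑ (suc n) (f ∘ clamp)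
  sum-tabulate zero    f = refl
  sum-tabulate (suc n) f = cong (f zero +_) (sum-tabulate n (f ∘ suc))

  sum-allFin : ∀ n (f : Fin (suc n) → ℕ) → sum (map f (allFin (suc n))) ≡ ∑ (suc n) (f ∘ clamp)
  sum-allFin n f = trans (cong sum (map-tabulate (λ i → i) f)) (sum-tabulate n f)

  sum-allFin² : ∀ k l (f : Fin (suc k) × Fin (suc l) → ℕ) →
    sum (map f (cartesianProduct (allFin (suc k)) (allFin (suc l)))) ≡
    ∑ (suc k) (λ x → ∑ (suc l) (λ y → f (clamp x , clamp y)))
  sum-allFin² k l f = trans (sum-map-cartesianProduct f (allFin (suc k)) (allFin (suc l)))
    (trans (sum-allFin k (λ x → sum (map (λ y → f (x , y)) (allFin (suc l)))))
           (∑-cong (suc k) (λ x → sum-allFin l (λ y → f (clamp x , y)))))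

  module _ (m : ℕ) where
    open Graph (grid (suc (suc m))) using (E; edges)
    private
      N = suc m
      hs = cartesianProduct (allFin N) (allFin (suc N))
      vs = cartesianProduct (allFin (suc N)) (allFin N)

    sum-edges : ∀ (f : E → ℕ) → sum (map f edges) ≡
      ∑ N (λ x → ∑ (suc N) (λ y → f (hEdge m x y))) + ∑ (suc N) (λ x → ∑ N (λ y → f (vEdge m x y)))
    sum-edges f = begin
      sum (map f (map inj₁ hs ++ map inj₂ vs))               ≡⟨ cong sum (map-++ f (map inj₁ hs) (map inj₂ vs)) ⟩
      sum (map f (map inj₁ hs) ++ map f (map inj₂ vs))       ≡⟨ sum-++ (map f (map inj₁ hs)) _ ⟩
      sum (map f (map inj₁ hs)) + sum (map f (map inj₂ vs))
        ≡⟨ cong₂ _+_ (cong sum (sym (map-∘ {g = f} {f = inj₁} hs))) (cong sum (sym (map-∘ {g = f} {f = inj₂} vs))) ⟩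
      sum (map (f ∘ inj₁) hs) + sum (map (f ∘ inj₂) vs)      ≡⟨ cong₂ _+_ (sum-allFin² m (suc m) (f ∘ inj₁)) (sum-allFin² (suc m) m (f ∘ inj₂)) ⟩
      _ ∎
      where open ≡-Reasoning

    length-edges : length edges ≤ 2 * (suc N * suc N)
    length-edges = begin
      length (map inj₁ hs ++ map inj₂ vs)          ≡⟨ length-++ (map inj₁ hs) ⟩
      length (map inj₁ hs) + length (map inj₂ vs)  ≡⟨ cong₂ _+_ (length-map inj₁ hs) (length-map inj₂ vs) ⟩
      length hs + length vs                        ≡⟨ cong₂ _+_ (size N (suc N)) (size (suc N) N) ⟩
      N * suc N + suc N * N                        ≤⟨ +-mono-≤ (*-monoˡ-≤ (suc N) (n≤1+n N)) (*-monoʳ-≤ (suc N) (n≤1+n N)) ⟩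
      suc N * suc N + suc N * suc N                ≡⟨ cong (suc N * suc N +_) (+-identityʳ (suc N * suc N)) ⟨
      2 * (suc N * suc N)                          ∎
      where
      open ≤-Reasoning
      size : ∀ k l → length (cartesianProduct (allFin k) (allFin l)) ≡ k * l
      size k l = trans (length-cartesianProduct (allFin k) (allFin l))
                       (cong₂ _*_ (length-tabulate {n = k} (λ i → i)) (length-tabulate {n = l} (λ i → i)))

    module _ (T : SpanningTree (grid (suc (suc m)))) where
      open SpanningTree T using (inTree?)

      -- Summing over all edges is harmless: `cycleLengthAt` is 0 on T, so tree edges exceed no
      -- threshold.
      longEdges : ℕ → ℕ
      longEdges j = sum (map (λ e → exceeds j (cycleLengthAt T e)) edges)

      many-longEdges : ∀ j s → suc (j + j) + s ≤ N → s * s ≤ 4 * (suc j * longEdges j)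
      many-longEdges j s w+s≤N = begin
        s * s
          ≤⟨ ring-count (λ x y → len (hEdge m x y)) (λ x y → len (vEdge m x y)) s (suc (j + j)) N w+s≤N hit ⟩
        suc (j + j) * (2 * (∑ N (λ x → ∑ (suc N) (λ y → len (hEdge m x y)))
                            + ∑ (suc N) (λ x → ∑ N (λ y → len (vEdge m x y)))))
                                           ≡⟨ cong (λ z → suc (j + j) * (2 * z)) (sum-edges len) ⟨
        -- Rounding the side `2j + 1` up to `2j + 2` produces the factor `4(j + 1)` that `harmonic`
        -- expects.
        suc (j + j) * (2 * longEdges j)    ≤⟨ *-monoˡ-≤ (2 * longEdges j) (n≤1+n (suc (j + j))) ⟩
        suc (suc (j + j)) * (2 * longEdges j) ≡⟨ rearrange j (longEdges j) ⟩
        4 * (suc j * longEdges j)          ∎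
        where
        open ≤-Reasoning
        len : E → ℕ
        len e = exceeds j (cycleLengthAt T e)
        rearrange : ∀ j g → suc (suc (j + j)) * (2 * g) ≡ 4 * (suc j * g)
        rearrange = solve-∀
        fits : ∀ {p} → p < s → suc (j + j) + p ≤ N
        fits p<s = ≤-trans (+-monoʳ-≤ (suc (j + j)) (<⇒≤ p<s)) w+s≤N
        hit : ∀ p q → p < s → q < s → _
        hit p q p<s q<s with ring-has-long m T {p} {q} {j} (fits p<s) (fits q<s)
        ... | t , t<w , inj₁ lt = t , t<w , inj₁ (exceeds≥1 lt)
        ... | t , t<w , inj₂ (inj₁ lt) = t , t<w , inj₂ (inj₁ (exceeds≥1 lt))
        ... | t , t<w , inj₂ (inj₂ (inj₁ lt)) = t , t<w , inj₂ (inj₂ (inj₁ (exceeds≥1 lt)))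
        ... | t , t<w , inj₂ (inj₂ (inj₂ lt)) = t , t<w , inj₂ (inj₂ (inj₂ (exceeds≥1 lt)))

      sum-cycleLengths : sum (fundamentalCycleLengths T) ≡ sum (map (cycleLengthAt T) edges)
      sum-cycleLengths = sum-map-mapMaybe
        (λ e → Maybe.map (e ,_) (dec⇒maybe (¬? (inTree? e))))
        (λ (e , e∉T) → cycleLength (fundamentalCycle T e e∉T)) edges

      sum-bound : ∀ K → 5 ^ suc K ≤ suc N → suc K * (suc N * suc N) ≤ 20 * sum (fundamentalCycleLengths T)
      sum-bound K 5B≤n = begin
        suc K * (suc N * suc N)             ≤⟨ *-monoʳ-≤ (suc K) (*-mono-≤ n≤2s n≤2s) ⟩
        suc K * ((2 * s) * (2 * s))         ≡⟨ rearrange (suc K) s ⟩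
        4 * (suc K * (s * s))               ≤⟨ *-monoʳ-≤ 4 (harmonic longEdges (s * s) K (λ j j<B → many-longEdges j s (fits j<B))) ⟩
        4 * (5 * ∑ B longEdges)
          ≤⟨ *-monoʳ-≤ 4 (*-monoʳ-≤ 5 (∑-sum≤ B _ (cycleLengthAt T) (λ e → ∑-exceeds B (cycleLengthAt T e)) edges)) ⟩
        4 * (5 * sum (map (cycleLengthAt T) edges)) ≡⟨ cong (λ z → 4 * (5 * z)) sum-cycleLengths ⟨
        4 * (5 * sum (fundamentalCycleLengths T))   ≡⟨ *-assoc 4 5 (sum (fundamentalCycleLengths T)) ⟨
        20 * sum (fundamentalCycleLengths T) ∎
        where
        open ≤-Reasoning
        B = 5 ^ K
        -- Rings with `j < B` have side at most `2 * B - 1`, so one `s` serves them all. As `4 * B`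
        -- is at most `suc N`, this `s` is still at least half of `suc N`; squaring the half costs
        -- the factor 4 in `20 = 4 * 5`.
        s = suc N ∸ 2 * B
        4B≤n : 4 * B ≤ suc N
        4B≤n = ≤-trans (m≤n+m (4 * B) B) 5B≤n
        2B≤n : 2 * B ≤ suc N
        2B≤n = ≤-trans (*-monoˡ-≤ B (s≤s (s≤s (z≤n {2})))) 4B≤n
        s+2B : s + 2 * B ≡ suc N
        s+2B = m∸n+n≡m 2B≤n
        rearrange : ∀ k s → k * ((2 * s) * (2 * s)) ≡ 4 * (k * (s * s))
        rearrange = solve-∀
        quadruple : ∀ b → 4 * b ≡ 2 * b + 2 * b
        quadruple = solve-∀
        2B≤s : 2 * B ≤ s
        2B≤s = +-cancelʳ-≤ (2 * B) (2 * B) s (begin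
          2 * B + 2 * B ≡⟨ quadruple B ⟨
          4 * B         ≤⟨ 4B≤n ⟩
          suc N         ≡⟨ s+2B ⟨
          s + 2 * B     ∎)
        n≤2s : suc N ≤ 2 * s
        n≤2s = begin
          suc N     ≡⟨ s+2B ⟨
          s + 2 * B ≤⟨ +-monoʳ-≤ s 2B≤s ⟩
          s + s     ≡⟨ cong (s +_) (+-identityʳ s) ⟨
          2 * s     ∎
        fits : ∀ {j} → j < B → suc (j + j) + s ≤ N
        fits {j} j<B = ≤-pred (begin
          suc (suc (j + j)) + s ≡⟨ rearr j s ⟩
          s + 2 * suc j     ≤⟨ +-monoʳ-≤ s (*-monoʳ-≤ 2 j<B) ⟩
          s + 2 * B         ≡⟨ s+2B ⟩
          suc N             ∎)
          where
          rearr : ∀ j s → suc (suc (j + j)) + s ≡ s + 2 * suc j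
          rearr = solve-∀

      length-fundamentalCycleLengths : length (fundamentalCycleLengths T) ≤ 2 * (suc N * suc N)
      length-fundamentalCycleLengths = begin
        length (fundamentalCycleLengths T) ≡⟨ length-map _ (nonTreeEdges T) ⟩
        length (nonTreeEdges T)            ≤⟨ length-mapMaybe (λ e → Maybe.map (e ,_) (dec⇒maybe (¬? (inTree? e)))) edges ⟩
        length edges                       ≤⟨ length-edges ⟩
        2 * (suc N * suc N)                ∎
        where open ≤-Reasoning

-- The logarithm and the rational mean

open import Data.Integer using (+_)
open import Data.Rational using (_/_; _*_; _≤_; toℚᵘ)

greatestExponent-≤ : ∀ b n m → 1 ℕ.≤ n → b ^ greatestExponent b n m ℕ.≤ n
-- The default exponent 0 is sound because `b ^ 0` is 1.
greatestExponent-≤ b n zero    1≤n = 1≤n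
greatestExponent-≤ b n (suc m) 1≤n with b ^ suc m ≤ᵇ n in eq
... | true  = ≤ᵇ⇒≤ (b ^ suc m) n (subst Bool.T (sym eq) _)
... | false = greatestExponent-≤ b n m 1≤n

-- Between unnormalised fractions the claim is the cross-multiplied inequality of natural numbers.
-- `mkℚᵘ` takes the denominator minus one, hence `length xs` for the list `x ∷ xs`.
≤-mean : ∀ a d k x xs → a ℕ.* k ℕ.* length (x ∷ xs) ℕ.≤ suc d ℕ.* sum (x ∷ xs) →
         (+ a / suc d) * (+ k / 1) ≤ mean (x ∷ xs)
≤-mean a d k x xs bound = ℚ.toℚᵘ-cancel-≤ (begin
  toℚᵘ ((+ a / suc d) * (+ k / 1))             ≃⟨ ℚ.toℚᵘ-homo-* (+ a / suc d) (+ k / 1) ⟩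
  toℚᵘ (+ a / suc d) ℚᵘ.* toℚᵘ (+ k / 1)       ≃⟨ ℚᵘ.*-cong (ℚ.toℚᵘ-fromℚᵘ (mkℚᵘ (+ a) d)) (ℚ.toℚᵘ-fromℚᵘ (mkℚᵘ (+ k) 0)) ⟩
  mkℚᵘ (+ a) d ℚᵘ.* mkℚᵘ (+ k) 0               ≤⟨ *≤* cross ⟩
  mkℚᵘ (+ sum (x ∷ xs)) (length xs)            ≃⟨ ℚ.toℚᵘ-fromℚᵘ (mkℚᵘ (+ sum (x ∷ xs)) (length xs)) ⟨
  toℚᵘ (mean (x ∷ xs))                         ∎)
  where
  open ℚᵘ.≤-Reasoning
  cross : (+ a ℤ.* + k) ℤ.* + length (x ∷ xs) ℤ.≤ + sum (x ∷ xs) ℤ.* + (suc d ℕ.* 1)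
  cross = subst₂ ℤ._≤_
    (trans (ℤ.pos-* (a ℕ.* k) (length (x ∷ xs))) (cong (ℤ._* + length (x ∷ xs)) (ℤ.pos-* a k)))
    (trans (cong +_ (trans (*-comm (suc d) (sum (x ∷ xs))) (cong (sum (x ∷ xs) ℕ.*_) (sym (*-identityʳ (suc d))))))
           (ℤ.pos-* (sum (x ∷ xs)) (suc d ℕ.* 1)))
    (ℤ.+≤+ bound)

mean-bound : ∀ k n xs → k ℕ.* (suc n ℕ.* suc n) ℕ.≤ 20 ℕ.* sum xs → length xs ℕ.≤ 2 ℕ.* (suc n ℕ.* suc n) →
             (+ 2 / 625) * (+ k / 1) ≤ mean xs
-- For an empty list, positive `k` would turn the first hypothesis into `suc _ ≤ 0`; only `k = 0` is
-- left, where both sides are 0.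
mean-bound zero    n []         _     _     = ℚ.≤-refl
mean-bound k       n xs@(y ∷ ys) large short = ≤-mean 2 624 k y ys (begin
  2 ℕ.* k ℕ.* length xs                    ≤⟨ *-monoʳ-≤ (2 ℕ.* k) short ⟩
  2 ℕ.* k ℕ.* (2 ℕ.* (suc n ℕ.* suc n))    ≡⟨ rearrange k (suc n ℕ.* suc n) ⟩
  4 ℕ.* (k ℕ.* (suc n ℕ.* suc n))          ≤⟨ *-monoʳ-≤ 4 large ⟩
  4 ℕ.* (20 ℕ.* sum xs)                    ≡⟨ *-assoc 4 20 (sum xs) ⟨
  -- The counting gives the constant `2/80`, which is weakened here to `2/625`.
  80 ℕ.* sum xs                            ≤⟨ *-monoˡ-≤ (sum xs) (≤ᵇ⇒≤ 80 625 _) ⟩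
  625 ℕ.* sum xs                           ∎)
  where
  open ≤-Reasoning
  rearrange : ∀ k q → 2 ℕ.* k ℕ.* (2 ℕ.* q) ≡ 4 ℕ.* (k ℕ.* q)
  rearrange = solve-∀

corollary5 : (n : ℕ) → 2 ℕ.≤ n → (T : SpanningTree (grid n)) →
    (+ 2 / 625) * (+ ⌊log[ 5 ] n ⌋ / 1) ≤ averageFundamentalCycleLength T
corollary5 (suc (suc m)) (s≤s (s≤s _)) T =
  mean-bound ⌊log[ 5 ] n ⌋ (suc m) (fundamentalCycleLengths T)
    (sum-bound′ ⌊log[ 5 ] n ⌋ (greatestExponent-≤ 5 n n (s≤s z≤n)))
    (length-fundamentalCycleLengths m T)
  where
  n = suc (suc m)
  sum-bound′ : ∀ k → 5 ^ k ℕ.≤ n → k ℕ.* (n ℕ.* n) ℕ.≤ 20 ℕ.* sum (fundamentalCycleLengths T)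
  -- A zero logarithm, as for `n < 5`, leaves nothing to show; otherwise `sum-bound` uses thresholds
  -- below the next smaller power of 5.
  sum-bound′ zero    _    = z≤n
  sum-bound′ (suc K) 5^≤n = sum-bound m T K 5^≤n
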